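{- If $T$ is a tree, then $\chi_D(T)=\chi_{D_\ell}(T)$.
   Context: A coloring of a graph $G$ is distinguishing if no nontrivial automorphism of $G$ preserves all vertex colors, and proper if adjacent vertices get different colors. The distinguishing chromatic number $\chi_D(G)$ is the minimum number of colors in a proper distinguishing coloring of $G$. Given lists $L=\{L(v)\}_{v\in V(G)}$, $G$ is properly $L$-distinguishable if there is a proper distinguishing coloring $f$ with $f(v)\in L(v)$ for all $v$. The list distinguishing chromatic number $\chi_{D_\ell}(G)$ is the minimum integer $k$ such that $G$ is properly $L$-distinguishable for every list assignment $L$ with $|L(v)|\ge k$ for all $v$. -}

module Defs where

open import Data.Nat using (ℕ; suc; _≤_; _<_)
open import Data.Fin using (Fin)
open import Data.List using (List; length; _∷_; []; _++_; [_])
open import Data.List.Relation.Unary.Unique.Propositional using (Unique)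
open import Data.List.Relation.Unary.Linked using (Linked)
open import Data.List.Membership.Propositional using (_∈_)
open import Data.Product using (Σ; Σ-syntax; ∃; _×_)
open import Relation.Nullary using (¬_)
open import Relation.Binary.PropositionalEquality using (_≡_; _≢_)
open import Data.Fin.Permutation using (Permutation′; _⟨$⟩ʳ_)
open import Function.Bundles using (_⇔_)

record Graph (n : ℕ) : Set₁ where
  field
    Adj    : Fin n → Fin n → Set
    sym    : ∀ {u v} → Adj u v → Adj v u
    irrefl : ∀ {v} → ¬ Adj v v

module _ {n : ℕ} (G : Graph n) where
  open Graph G

  data Walk : Fin n → Fin n → Set where
    here : ∀ {v} → Walk v v
    step : ∀ {u w v} → Adj u w → Walk w v → Walk u v

  Connected : Set
  Connected = ∀ u v → Walk u v

  Cycle : Set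
  Cycle = Σ[ x ∈ Fin n ] Σ[ xs ∈ List (Fin n) ]
            (2 ≤ length xs × Unique (x ∷ xs) × Linked Adj (x ∷ xs ++ [ x ]))

  IsTree : Set
  IsTree = 1 ≤ n × Connected × ¬ Cycle

  IsAutomorphism : Permutation′ n → Set
  IsAutomorphism σ = ∀ u v → Adj u v ⇔ Adj (σ ⟨$⟩ʳ u) (σ ⟨$⟩ʳ v)

  Proper : ∀ {C : Set} → (Fin n → C) → Set
  Proper f = ∀ u v → Adj u v → f u ≢ f v

  Distinguishing : ∀ {C : Set} → (Fin n → C) → Set
  Distinguishing f = ∀ (σ : Permutation′ n) → IsAutomorphism σ →
                     (∀ v → f (σ ⟨$⟩ʳ v) ≡ f v) → ∀ v → σ ⟨$⟩ʳ v ≡ v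

  DistColorable : ℕ → Set
  DistColorable k = Σ[ f ∈ (Fin n → Fin k) ] (Proper f × Distinguishing f)

  LDistinguishable : (Fin n → List ℕ) → Set
  LDistinguishable L = Σ[ f ∈ (Fin n → ℕ) ] ((∀ v → f v ∈ L v) × Proper f × Distinguishing f)

  ListDistColorable : ℕ → Set
  ListDistColorable k = ∀ (L : Fin n → List ℕ) →
                        (∀ v → Unique (L v) × k ≤ length (L v)) → LDistinguishable L

IsMinimum : (ℕ → Set) → ℕ → Set
IsMinimum P k = P k × (∀ j → j < k → ¬ P j)

χD≡ : ∀ {n} → Graph n → ℕ → Set
χD≡ G = IsMinimum (DistColorable G)

χDℓ≡ : ∀ {n} → Graph n → ℕ → Set
χDℓ≡ G = IsMinimum (ListDistColorable G)

{-# OPTIONS --safe #-}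

-- The vertices minimising the sum of distances to all vertices are either one vertex or two
-- adjacent ones, since this sum is strictly convex along paths. Fix one of them, c. Every
-- automorphism maps c to itself or to a neighbour, so one that preserves a proper colouring
-- fixes c, and the tree may be treated as rooted at c. A proper colouring of a rooted tree is
-- distinguishing iff siblings never have isomorphic coloured subtrees. When all lists equal
-- {0, …, k − 1}, the number A(v) of isomorphism classes of such colourings of the subtree at v
-- with a prescribed colour of v depends only on the isomorphism type of the subtree, and it is
-- the product of the binomials C((k − 1) A(w), m) over the types of subtrees at children w, m
-- being the multiplicity of the type. For arbitrary lists of size at least k it is a lower bound:
-- sets S₁, …, Sₘ of size at least N have at least C(N, m) transversals (as sets), by Pascal's
-- recursion on whether a fixed element of S₁ is used. If T has a proper distinguishing
-- k-colouring then A(c) ≥ 1, and so every assignment of lists of size k admits one as well.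

module Submission where

import Algebra.Properties.CommutativeMonoid.Sum as Sum
open import Data.Empty using (⊥-elim)
open import Data.Fin using (Fin; zero; suc; punchOut; toℕ; fromℕ<)
open import Data.Fin.Permutation using (Permutation′; permutation; _⟨$⟩ʳ_; _⟨$⟩ˡ_; inverseˡ; inverseʳ)
open import Data.Fin.Permutation.Components using (transpose; transpose-inverse)
import Data.Fin.Properties as Fin
open import Data.List using (List; []; _∷_; [_]; length; _++_; map; filter; allFin; upTo)
open import Data.List.Extrema.Nat using (argmin; f[argmin]≤f[xs])
import Data.List.Membership.DecPropositional as DecMembership
open import Data.List.Membership.Propositional using (_∈_; _∉_)
open import Data.List.Membership.Propositional.Properties using (∈-allFin; ∈-upTo⁺; ∈-upTo⁻; ∈-filter⁺; ∈-filter⁻; ∈-map⁺; ∈-map⁻; ∈-++⁺ˡ; ∈-++⁺ʳ; ∈-∃++)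
open import Data.List.Membership.Propositional.Properties.WithK using (unique∧set⇒bag)
open import Data.List.Properties using (length-map; map-id; length-++; length-filter; filter-notAll; filter-all; map-cong-local; map-∘; length-upTo; ∷-injective)
open import Data.List.Relation.Binary.BagAndSetEquality using (∼bag⇒↭)
open import Data.List.Relation.Binary.Permutation.Propositional using (_↭_; ↭-refl; ↭-sym; ↭-trans; ↭-reflexive; prep; ↭⇒↭ₛ)
open import Data.List.Relation.Binary.Permutation.Propositional.Properties as Perm using (∈-resp-↭; All-resp-↭; drop-∷; ↭-map-inv; shift)
import Data.List.Relation.Binary.Permutation.Setoid.Properties as PermSetoid
open import Data.List.Relation.Binary.Pointwise as Pointwise using (Pointwise; []; _∷_)
open import Data.List.Relation.Unary.All as All using (All; []; _∷_)
import Data.List.Relation.Unary.All.Properties as All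
open import Data.List.Relation.Unary.AllPairs as AllPairs using (AllPairs; []; _∷_)
import Data.List.Relation.Unary.AllPairs.Properties as AllPairs
open import Data.List.Relation.Unary.Any as Any using (here; there)
import Data.List.Relation.Unary.Any.Properties as Any
open import Data.List.Relation.Unary.Linked using (Linked; [-]; _∷_)
import Data.List.Relation.Unary.Sorted.TotalOrder.Properties as Sorted
open import Data.List.Relation.Unary.Unique.Propositional using (Unique)
import Data.List.Relation.Unary.Unique.Propositional.Properties as Unique
import Data.List.Sort
open import Data.Nat using (ℕ; zero; suc; pred; _+_; _*_; _∸_; _⊔_; _≤_; _<_; _≤?_; _≟_; z≤n; s≤s)
open import Data.Nat.Properties
open import Data.Product using (Σ-syntax; ∃; _×_; _,_; -,_; proj₁; proj₂; map₁; map₂)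
open import Data.Sum using (_⊎_; inj₁; inj₂; [_,_]′; swap)
open import Defs
open import Function using (_∘_; id)
open import Function.Bundles using (_⇔_; mk⇔; Equivalence)
open import Relation.Binary.Bundles using (DecTotalOrder)
open import Relation.Binary.Construct.Closure.ReflexiveTransitive using (Star; ε; _◅_; _◅◅_; reverse)
open import Relation.Binary.Definitions using (DecidableEquality)
open import Relation.Binary.PropositionalEquality using (_≡_; _≢_; refl; sym; trans; cong; cong₂; subst; subst₂; setoid; isEquivalence; module ≡-Reasoning)
open import Relation.Nullary using (¬_; Dec; yes; no)
open import Relation.Nullary.Decidable using (¬?; map′; _×-dec_)
open import Relation.Unary using (Decidable)

open Sum +-0-commutativeMonoid using (sum; sum-permute; ∑-distrib-+; sum-cong-≗)

-- Deletion and duplicate-free lists.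

module Delete {A : Set} (_≟A_ : DecidableEquality A) where

  abstract

    delete : A → List A → List A
    delete x = filter (λ y → ¬? (y ≟A x))

    ∈-delete⁺ : ∀ {x y xs} → y ∈ xs → y ≢ x → y ∈ delete x xs
    ∈-delete⁺ = ∈-filter⁺ (λ y → ¬? (y ≟A _))

    ∈-delete⁻ : ∀ {x y xs} → y ∈ delete x xs → y ∈ xs × y ≢ x
    ∈-delete⁻ = ∈-filter⁻ (λ y → ¬? (y ≟A _))

    delete-unique : ∀ {x xs} → Unique xs → Unique (delete x xs)
    delete-unique = Unique.filter⁺ (λ y → ¬? (y ≟A _))

    delete-∉ : ∀ {x xs} → x ∉ xs → delete x xs ≡ xs
    delete-∉ {x} x∉ = filter-all (λ y → ¬? (y ≟A x)) (All.tabulate λ y∈ y≡x → x∉ (subst (_∈ _) y≡x y∈))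

    length-delete-∈ : ∀ {x xs} → x ∈ xs → length (delete x xs) < length xs
    length-delete-∈ {x} {xs} x∈ =
      filter-notAll (λ y → ¬? (y ≟A x)) xs (Any.map (λ x≡y y≢x → y≢x (sym x≡y)) x∈)

    length-delete-unique : ∀ x {xs} → Unique xs → length xs ≤ suc (length (delete x xs))
    length-delete-unique x [] = z≤n
    length-delete-unique x {y ∷ ys} (y∉ ∷ u) with y ≟A x
    ... | yes refl = s≤s (≤-reflexive (sym (cong length (delete-∉ (All.All¬⇒¬Any y∉)))))
    ... | no  _    = s≤s (length-delete-unique x u)

module _ {A : Set} where

  unique-resp-↭ : ∀ {xs ys : List A} → xs ↭ ys → Unique xs → Unique ys
  unique-resp-↭ p = PermSetoid.Unique-resp-↭ (setoid A) (↭⇒↭ₛ p)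

  ∈⇒↭∷ : ∀ {x : A} {xs} → x ∈ xs → ∃ λ ys → xs ↭ x ∷ ys
  ∈⇒↭∷ {x} x∈ with ys , zs , refl ← ∈-∃++ x∈ = ys ++ zs , shift x ys zs

module _ {A B : Set} (g : A → B) where

  unique-map⇒injective : ∀ {xs x y} → Unique (map g xs) → x ∈ xs → y ∈ xs → g x ≡ g y → x ≡ y
  unique-map⇒injective _        (here refl) (here refl) _ = refl
  unique-map⇒injective (n ∷ _) (here refl) (there y∈) e = ⊥-elim (All.lookup n (∈-map⁺ g y∈) e)
  unique-map⇒injective (n ∷ _) (there x∈) (here refl) e = ⊥-elim (All.lookup n (∈-map⁺ g x∈) (sym e))
  unique-map⇒injective (_ ∷ u) (there x∈) (there y∈) e = unique-map⇒injective u x∈ y∈ e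

  injective⇒unique-map : ∀ {xs} → Unique xs → (∀ {x y} → x ∈ xs → y ∈ xs → g x ≡ g y → x ≡ y) → Unique (map g xs)
  injective⇒unique-map [] inj = []
  injective⇒unique-map (x∉ ∷ u) inj =
    All.map⁺ (All.tabulate λ y∈ e → All.lookup x∉ y∈ (inj (here refl) (there y∈) e))
    ∷ injective⇒unique-map u (λ x∈ y∈ → inj (there x∈) (there y∈))

-- Coloured rooted trees

data Tree : Set where
  node : ℕ → List Tree → Tree

label : Tree → ℕ
label (node c _) = c

-- The number 2 ^ a * (2 * b + 1), which determines a and b. Through `encode` it supplies decidable
-- equality of trees and the linear order by which siblings are sorted.
pair : ℕ → ℕ → ℕ
pair zero    b = suc (b + b)
pair (suc a) b = pair a b + pair a b

double-injective : ∀ {a b} → a + a ≡ b + b → a ≡ b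
double-injective {zero}  {zero}  _ = refl
double-injective {suc a} {suc b} e =
  cong suc (double-injective (suc-injective (trans (sym (+-suc a a)) (trans (suc-injective e) (+-suc b b)))))

odd≢even : ∀ a b → suc (a + a) ≢ b + b
odd≢even zero    (suc b) e with () ← trans (suc-injective e) (+-suc b b)
odd≢even (suc a) (suc b) e =
  odd≢even a b (suc-injective (trans (cong suc (sym (+-suc a a))) (trans (suc-injective e) (+-suc b b))))

pair-injective : ∀ a b c d → pair a b ≡ pair c d → a ≡ c × b ≡ d
pair-injective zero    b zero    d e = refl , double-injective (suc-injective e)
pair-injective zero    b (suc c) d e = ⊥-elim (odd≢even b (pair c d) e)
pair-injective (suc a) b zero    d e = ⊥-elim (odd≢even d (pair a b) (sym e))
pair-injective (suc a) b (suc c) d e =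
  map₁ (cong suc) (pair-injective a b c d (double-injective e))

encode    : Tree → ℕ
encode-forest : List Tree → ℕ
encode (node c ts) = pair c (encode-forest ts)
encode-forest []       = 0
encode-forest (t ∷ ts) = suc (pair (encode t) (encode-forest ts))

encode-injective : ∀ s t → encode s ≡ encode t → s ≡ t
encode-forest-injective : ∀ ss ts → encode-forest ss ≡ encode-forest ts → ss ≡ ts
encode-injective (node c ss) (node d ts) e with pair-injective c _ d _ e
... | refl , e′ = cong (node c) (encode-forest-injective ss ts e′)
encode-forest-injective []       []       e = refl
encode-forest-injective (s ∷ ss) (t ∷ ts) e with pair-injective (encode s) _ (encode t) _ (suc-injective e)
... | e₁ , e₂ = cong₂ _∷_ (encode-injective s t e₁) (encode-forest-injective ss ts e₂)

_≟ᵗ_ : DecidableEquality Tree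
s ≟ᵗ t = map′ (encode-injective s t) (cong encode) (encode s ≟ encode t)

treeOrder : DecTotalOrder _ _ _
treeOrder = record
  { Carrier = Tree ; _≈_ = _≡_ ; _≤_ = λ s t → encode s ≤ encode t
  ; isDecTotalOrder = record
    { isTotalOrder = record
      { isPartialOrder = record
        { isPreorder = record { isEquivalence = isEquivalence ; reflexive = λ { refl → ≤-refl } ; trans = ≤-trans }
        ; antisym = λ p q → encode-injective _ _ (≤-antisym p q) }
      ; total = λ s t → ≤-total (encode s) (encode t) }
    ; _≟_ = _≟ᵗ_
    ; _≤?_ = λ s t → encode s ≤? encode t } }

open Data.List.Sort treeOrder using (sort; sort-↭; sort-↗)

sort-cong-↭ : ∀ {ss ts} → ss ↭ ts → sort ss ≡ sort ts
sort-cong-↭ {ss} {ts} p = Pointwise.Pointwise-≡⇒≡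
  (Sorted.↗↭↗⇒≋ (DecTotalOrder.totalOrder treeOrder) (sort-↗ ss) (sort-↗ ts)
    (↭⇒↭ₛ (↭-trans (sort-↭ ss) (↭-trans p (↭-sym (sort-↭ ts))))))

-- The order of siblings being irrelevant, isomorphic coloured trees built with mk are equal.
mk : ℕ → List Tree → Tree
mk c ts = node c (sort ts)

mk-cong-↭ : ∀ c {ss ts} → ss ↭ ts → mk c ss ≡ mk c ts
mk-cong-↭ c p = cong (node c) (sort-cong-↭ p)

mk-injective : ∀ {c d ss ts} → mk c ss ≡ mk d ts → c ≡ d × ss ↭ ts
mk-injective {c} {d} {ss} {ts} e = cong label e ,
  ↭-trans (↭-sym (sort-↭ ss)) (↭-trans (↭-reflexive (cong sub e)) (sort-↭ ts))
  where
  sub : Tree → List Tree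
  sub (node _ us) = us

-- Counting transversals

decrement : Tree → (Tree → ℕ) → Tree → ℕ
decrement τ N τ′ with τ′ ≟ᵗ τ
... | yes _ = pred (N τ′)
... | no  _ = N τ′

decrement-≡ : ∀ τ N → decrement τ N τ ≡ pred (N τ)
decrement-≡ τ N with τ ≟ᵗ τ
... | yes _ = refl
... | no ≢  = ⊥-elim (≢ refl)

-- If the sets X_τ are pairwise disjoint and |X_τ| = N τ, then transversals N (τ₁ ∷ … ∷ τₘ)
-- is the number of sets {x₁, …, xₘ} with xᵢ ∈ X_τᵢ pairwise distinct. The recursion is
-- Pascal's: fix x ∈ X_τ₁ and distinguish whether it is used.
transversals  : (Tree → ℕ) → List Tree → ℕ
transversals⁺ : (Tree → ℕ) → Tree → List Tree → ℕ → ℕ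
transversals N []       = 1
transversals N (τ ∷ τs) = transversals⁺ N τ τs (N τ)
transversals⁺ N τ τs zero    = 0
transversals⁺ N τ τs (suc n) = transversals (decrement τ N) τs + transversals⁺ (decrement τ N) τ τs n

module Transversals (κ : Tree → Tree) where

  open Delete _≟ᵗ_

  -- Sets for different types are disjoint, since `κ` recovers the type from an element; sets for
  -- equal types may overlap in any way.
  record Candidates (N : Tree → ℕ) (τ : Tree) (S : List Tree) : Set where
    constructor candidates
    field
      unique : Unique S
      type   : ∀ {y} → y ∈ S → κ y ≡ τ
      size   : N τ ≤ length S

  candidates-delete : ∀ {N τ x} → κ x ≡ τ → ∀ {τ′ S} → Candidates N τ′ S →
                      Candidates (decrement τ N) τ′ (delete x S)
  candidates-delete {N} {τ} {x} κx {τ′} {S} (candidates u t s) = candidates (delete-unique u) (t ∘ proj₁ ∘ ∈-delete⁻) size′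
    where
    size′ : decrement τ N τ′ ≤ length (delete x S)
    size′ with τ′ ≟ᵗ τ
    ... | yes _  = pred-mono-≤ (≤-trans s (length-delete-unique x u))
    ... | no τ′≢ = ≤-trans s (≤-reflexive (sym (cong length (delete-∉ (λ x∈ → τ′≢ (trans (sym (t x∈)) κx))))))

  -- Pairwise inequivalence under `↭` means that transversals are counted as sets. It makes the
  -- resulting codes differ, as `mk` forgets the order of the children.
  record Lower (Ss : List (List Tree)) (a : ℕ) : Set where
    constructor lower
    field
      family       : List (List Tree)
      transversal  : All (λ ys → Pointwise _∈_ ys Ss × Unique ys) family
      inequivalent : AllPairs (λ ys zs → ¬ (ys ↭ zs)) family
      size         : a ≤ length family

  undelete : ∀ {x ys Ss} → Pointwise _∈_ ys (map (delete x) Ss) → Pointwise _∈_ ys Ss × All (x ≢_) ys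
  undelete {Ss = []}     []       = [] , []
  undelete {Ss = S ∷ Ss} (p ∷ ps) with ∈-delete⁻ {xs = S} p | undelete {Ss = Ss} ps
  ... | y∈ , y≢x | qs , rs = y∈ ∷ qs , (y≢x ∘ sym) ∷ rs

  -- Pascal's recursion on the first element x of the first set: either x is prepended to a
  -- transversal of the other sets with x deleted, or x is deleted from all sets. The equation
  -- `n ≡ N τ` is an invariant; n is a separate argument to keep the recursion structural.
  lower-transversals  : ∀ N {τs Ss} → Pointwise (Candidates N) τs Ss → Lower Ss (transversals N τs)
  lower-transversals⁺ : ∀ N {τ τs S Ss} n → n ≡ N τ → Candidates N τ S → Pointwise (Candidates N) τs Ss →
                        Lower (S ∷ Ss) (transversals⁺ N τ τs n)
  lower-transversals N []       = lower ([] ∷ []) (([] , []) ∷ []) ([] ∷ []) ≤-refl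
  lower-transversals N (c ∷ cs) = lower-transversals⁺ N _ refl c cs
  lower-transversals⁺ N zero    _ _ _ = lower [] [] [] z≤n
  lower-transversals⁺ N {S = []} (suc n) e (candidates _ _ s) cs with () ← subst (_≤ 0) (sym e) s
  lower-transversals⁺ N {τ} {τs} {S = x ∷ S} {Ss} (suc n) e c cs = combine
    (lower-transversals (decrement τ N) cs′)
    (lower-transversals⁺ (decrement τ N) n (trans (cong pred e) (sym (decrement-≡ τ N))) (del c) cs′)
    where
    κx : κ x ≡ τ
    κx = Candidates.type c (here refl)
    del : ∀ {τ′ S′} → Candidates N τ′ S′ → Candidates (decrement τ N) τ′ (delete x S′)
    del = candidates-delete κx
    cs′ : Pointwise (Candidates (decrement τ N)) τs (map (delete x) Ss)
    cs′ = subst (λ ts → Pointwise _ ts _) (map-id τs) (Pointwise.map⁺ id (delete x) (Pointwise.map del cs))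
    combine : ∀ {a b} → Lower (map (delete x) Ss) a → Lower (map (delete x) ((x ∷ S) ∷ Ss)) b →
              Lower ((x ∷ S) ∷ Ss) (a + b)
    combine (lower R₁ t₁ i₁ s₁) (lower R₂ t₂ i₂ s₂) = lower (map (x ∷_) R₁ ++ R₂)
      (All.++⁺ (All.map⁺ (All.map (λ { (p , u) → let q , r = undelete p in (here refl ∷ q) , (r ∷ u) }) t₁))
               (All.map (λ { (p , u) → proj₁ (undelete {Ss = (x ∷ S) ∷ Ss} p) , u }) t₂))
      -- Every member of the first family contains x and no member of the second does.
      (AllPairs.++⁺ (AllPairs.map⁺ (AllPairs.map (_∘ drop-∷) i₁)) i₂
        (All.map⁺ (All.tabulate λ _ → All.map (λ { (p , _) q →
          All.All¬⇒¬Any (proj₂ (undelete {Ss = (x ∷ S) ∷ Ss} p)) (∈-resp-↭ q (here refl)) }) t₂)))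
      (≤-trans (+-mono-≤ s₁ s₂) (≤-reflexive (sym (trans (length-++ (map (x ∷_) R₁)) (cong (_+ length R₂) (length-map (x ∷_) R₁))))))

  record Cover (P : Tree → Set) (τ : Tree) (a : ℕ) : Set where
    constructor cover
    field
      list     : List Tree
      type     : ∀ {y} → y ∈ list → κ y ≡ τ
      complete : ∀ {y} → P y → κ y ≡ τ → y ∈ list
      size     : length list ≤ a

  record Upper (P : Tree → Set) (τs : List Tree) (a : ℕ) : Set where
    constructor upper
    field
      family   : List (List Tree)
      complete : ∀ {ys} → All P ys → Unique ys → map κ ys ↭ τs → ∃ λ zs → zs ∈ family × ys ↭ zs
      size     : length family ≤ a

  -- The same recursion from above, with x the first element of the list covering `τ`: a
  -- duplicate-free `ys` either contains x once and its other entries avoid x, or it avoids x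
  -- altogether.
  upper-transversals  : ∀ {P} N τs → (∀ {τ} → τ ∈ τs → Cover P τ (N τ)) → Upper P τs (transversals N τs)
  upper-transversals⁺ : ∀ {P} N τ τs n → n ≡ N τ → Cover P τ n → (∀ {τ} → τ ∈ τs → Cover P τ (N τ)) →
                        Upper P (τ ∷ τs) (transversals⁺ N τ τs n)
  upper-transversals N [] _ = upper ([] ∷ []) complete ≤-refl
    where
    complete : ∀ {ys} → All _ ys → Unique ys → map κ ys ↭ [] → ∃ λ zs → zs ∈ [] ∷ [] × ys ↭ zs
    complete {[]}    _ _ _ = [] , here refl , ↭-refl
    complete {_ ∷ _} _ _ p = ⊥-elim (Perm.¬x∷xs↭[] p)
  upper-transversals N (τ ∷ τs) C = upper-transversals⁺ N τ τs (N τ) refl (C (here refl)) (C ∘ there)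
  upper-transversals⁺ {P} N τ τs n e (cover [] _ comp _) C = upper [] none z≤n
    where
    none : ∀ {ys} → All P ys → Unique ys → map κ ys ↭ τ ∷ τs → ∃ λ zs → zs ∈ [] × ys ↭ zs
    none ps _ p with y , y∈ , τ≡ ← ∈-map⁻ κ (∈-resp-↭ (↭-sym p) (here refl)) with () ← comp (All.lookup ps y∈) (sym τ≡)
  upper-transversals⁺ {P} N τ τs (suc n) e (cover (x ∷ X) ty comp (s≤s s)) C = combine
    (upper-transversals (decrement τ N) τs C′)
    (upper-transversals⁺ (decrement τ N) τ τs n (trans (cong pred e) (sym (decrement-≡ τ N))) cov C′)
    where
    -- Both recursive calls concern elements other than x, so recording this in the predicate lets
    -- the cover shrink to `X`.
    P′ : Tree → Set
    P′ y = P y × x ≢ y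
    cov : Cover P′ τ n
    cov = cover X (ty ∘ there) (λ { (p , ≢x) κy → strip ≢x (comp p κy) }) s
      where
      strip : ∀ {y} → x ≢ y → y ∈ x ∷ X → y ∈ X
      strip ≢x (here y≡x) = ⊥-elim (≢x (sym y≡x))
      strip _  (there y∈) = y∈
    C′ : ∀ {τ′} → τ′ ∈ τs → Cover P′ τ′ (decrement τ N τ′)
    C′ {τ′} τ′∈ with τ′ ≟ᵗ τ | C τ′∈
    -- A repetition of `τ` must use the shortened list; the cover supplied by `C` is only known to
    -- have size at most `N τ`.
    ... | yes refl | _ = subst (Cover P′ τ) (cong pred e) cov
    ... | no _     | cover Y ty′ comp′ s′ = cover Y ty′ (comp′ ∘ proj₁) s′
    combine : ∀ {a b} → Upper P′ τs a → Upper P′ (τ ∷ τs) b → Upper P (τ ∷ τs) (a + b)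
    combine {a} {b} (upper R₁ c₁ s₁) (upper R₂ c₂ s₂) = upper (map (x ∷_) R₁ ++ R₂) complete
      (≤-trans (≤-reflexive (trans (length-++ (map (x ∷_) R₁)) (cong (_+ length R₂) (length-map (x ∷_) R₁)))) (+-mono-≤ s₁ s₂))
      where
      complete : ∀ {ys} → All P ys → Unique ys → map κ ys ↭ τ ∷ τs → ∃ λ zs → zs ∈ map (x ∷_) R₁ ++ R₂ × ys ↭ zs
      complete {ys} ps u p with Any.any? (x ≟ᵗ_) ys
      ... | no x∉ = map₂ (map₁ (∈-++⁺ʳ _)) (c₂ (All.zip (ps , All.¬Any⇒All¬ ys x∉)) u p)
      ... | yes x∈ with ys′ , q ← ∈⇒↭∷ x∈ with All-resp-↭ q ps | unique-resp-↭ q u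
      ...   | _ ∷ ps′ | x∉ ∷ u′ with c₁ (All.zip (ps′ , x∉)) u′
              (drop-∷ (subst (λ t → t ∷ map κ ys′ ↭ τ ∷ τs) (ty (here refl)) (↭-trans (Perm.map⁺ κ (↭-sym q)) p)))
      ...     | zs , zs∈ , r = x ∷ zs , ∈-++⁺ˡ (∈-map⁺ (x ∷_) zs∈) , ↭-trans q (prep x r)

-- Good colourings of a rooted tree

bounded : ∀ {n} (g : Fin n → ℕ) → ∃ λ b → ∀ i → g i < b
bounded {zero}  g = 0 , λ ()
bounded {suc n} g with b , g<b ← bounded (g ∘ suc) = suc (g zero) ⊔ b , λ
  { zero    → m≤m⊔n _ b
  ; (suc i) → ≤-trans (g<b i) (m≤n⊔m _ b) }

module _ {A : Set} (Q : ℕ → A → Set) where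

  disjoint-union : (∀ {c d y} → Q c y → Q d y → c ≡ d) → ∀ {a cs} → Unique cs →
    (∀ {c} → c ∈ cs → ∃ λ R → Unique R × (∀ {y} → y ∈ R → Q c y) × a ≤ length R) →
    ∃ λ R → Unique R × (∀ {y} → y ∈ R → ∃ λ c → c ∈ cs × Q c y) × length cs * a ≤ length R
  disjoint-union Q-func []        S = [] , [] , (λ ()) , z≤n
  disjoint-union Q-func {cs = c ∷ cs} (c∉ ∷ u) S
    with R₁ , u₁ , q₁ , s₁ ← S (here refl)
       | R₂ , u₂ , q₂ , s₂ ← disjoint-union Q-func u (S ∘ there)
    = R₁ ++ R₂ , Unique.++⁺ u₁ u₂ disjoint , q ∘ Any.++⁻ R₁ , ≤-trans (+-mono-≤ s₁ s₂) (≤-reflexive (sym (length-++ R₁)))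
    where
    disjoint : ∀ {y} → ¬ (y ∈ R₁ × y ∈ R₂)
    disjoint (y∈₁ , y∈₂) with d , d∈ , qd ← q₂ y∈₂ = All.lookup c∉ d∈ (Q-func (q₁ y∈₁) qd)
    q : ∀ {y} → y ∈ R₁ ⊎ y ∈ R₂ → ∃ λ d → d ∈ c ∷ cs × Q d y
    q (inj₁ y∈) = c , here refl , q₁ y∈
    q (inj₂ y∈) = map₂ (map₁ there) (q₂ y∈)

  union-cover : ∀ {a} cs →
    (∀ {c} → c ∈ cs → ∃ λ U → (∀ {y} → Q c y → y ∈ U) × length U ≤ a) →
    ∃ λ U → (∀ {c y} → c ∈ cs → Q c y → y ∈ U) × length U ≤ length cs * a
  union-cover []       S = [] , (λ ()) , z≤n
  union-cover (c ∷ cs) S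
    with U₁ , q₁ , s₁ ← S (here refl) | U₂ , q₂ , s₂ ← union-cover cs (S ∘ there)
    = U₁ ++ U₂ , (λ { (here refl) q → ∈-++⁺ˡ (q₁ q) ; (there c∈) q → ∈-++⁺ʳ U₁ (q₂ c∈ q) })
    , ≤-trans (≤-reflexive (length-++ U₁)) (+-mono-≤ s₁ s₂)

-- Transversals are lists parallel to a list of vertices, whereas `Good` and `Matching` ask for
-- functions on vertices. `b` is the value off `xs`.
interpolate : ∀ {A B : Set} → DecidableEquality A → B → ∀ {R : A → B → Set} {xs ys} → Unique xs → Pointwise R xs ys →
              ∃ λ (g : A → B) → map g xs ≡ ys × (∀ {x} → x ∈ xs → R x (g x))
interpolate _≟A_ b [] [] = (λ _ → b) , refl , λ ()
interpolate _≟A_ b {R} {x ∷ xs} {y ∷ ys} (x∉ ∷ u) (r ∷ rs) with g , eq , rel ← interpolate _≟A_ b u rs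
  = h , cong₂ _∷_ h-x (trans (map-cong-local (All.map h-≢ x∉)) eq)
  , λ { (here refl) → subst (R x) (sym h-x) r ; (there z∈) → subst (R _) (sym (h-≢ (All.lookup x∉ z∈))) (rel z∈) }
  where
  h : _ → _
  h z with x ≟A z
  ... | yes _ = y
  ... | no _  = g z
  h-x : h x ≡ y
  h-x with x ≟A x
  ... | yes _ = refl
  ... | no x≢x = ⊥-elim (x≢x refl)
  h-≢ : ∀ {z} → x ≢ z → h z ≡ g z
  h-≢ {z} x≢z with x ≟A z
  ... | yes x≡z = ⊥-elim (x≢z x≡z)
  ... | no _ = refl

module RootedTree {n : ℕ} (root : Fin n) (parent : Fin n → Fin n) (depth : Fin n → ℕ)
  (depth-root : depth root ≡ 0) (depth-parent : ∀ {v} → v ≢ root → depth v ≡ suc (depth (parent v))) where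

  -- The root is excluded explicitly because in the application `parent` maps it to itself.
  Child : Fin n → Fin n → Set
  Child v w = w ≢ root × parent w ≡ v

  abstract

    children : Fin n → List (Fin n)
    children v = filter (λ w → ¬? (w Fin.≟ root) ×-dec (parent w Fin.≟ v)) (allFin n)

    ∈-children⁺ : ∀ {v w} → Child v w → w ∈ children v
    ∈-children⁺ = ∈-filter⁺ (λ w → ¬? (w Fin.≟ root) ×-dec (parent w Fin.≟ _)) (∈-allFin _)

    ∈-children⁻ : ∀ {v w} → w ∈ children v → Child v w
    ∈-children⁻ w∈ = proj₂ (∈-filter⁻ (λ w → ¬? (w Fin.≟ root) ×-dec (parent w Fin.≟ _)) {xs = allFin n} w∈)

    children-unique : ∀ v → Unique (children v)
    children-unique v = Unique.filter⁺ (λ w → ¬? (w Fin.≟ root) ×-dec (parent w Fin.≟ v)) (Unique.allFin⁺ n)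

  depth-child : ∀ {v w} → w ∈ children v → depth w ≡ suc (depth v)
  depth-child w∈ with w≢root , refl ← ∈-children⁻ w∈ = depth-parent w≢root

  private
    D : ℕ
    D = proj₁ (bounded depth)
    depth<D : ∀ v → depth v < D
    depth<D = proj₂ (bounded depth)

  -- Recursion on `h`, which bounds how far v lies above the depth `D` that no vertex reaches.
  bottom-up : (P : Fin n → Set) → (∀ v → (∀ {w} → w ∈ children v → P w) → P v) → ∀ v → P v
  bottom-up P ind v = go D v (m≤m+n _ (depth v))
    where
    go : ∀ h v → D ≤ h + depth v → P v
    go zero    v D≤ = ⊥-elim (<⇒≱ (depth<D v) D≤)
    go (suc h) v D≤ = ind v λ {w} w∈ →
      go h w (≤-trans D≤ (≤-reflexive (trans (sym (+-suc h (depth v))) (cong (h +_) (sym (depth-child w∈))))))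

  top-down : (P : Fin n → Set) → P root → (∀ {v} → v ≢ root → P (parent v) → P v) → ∀ v → P v
  top-down P base ind v = go (depth v) v refl
    where
    go : ∀ d v → depth v ≡ d → P v
    go d v e with v Fin.≟ root
    go d       v e | yes refl = base
    go zero    v e | no v≢ with () ← trans (sym e) (depth-parent v≢)
    go (suc d) v e | no v≢ = ind v≢ (go d (parent v) (suc-injective (trans (sym (depth-parent v≢)) e)))

  module _ {B : Set} (b : B) (next : Fin n → B → B) where
    private
      go : ℕ → Fin n → B
      go zero    v = b
      go (suc d) v = next v (go d (parent v))

    unfold : Fin n → B
    unfold v = go (depth v) v

    unfold-root : unfold root ≡ b
    unfold-root = cong (λ d → go d root) depth-root

    unfold-parent : ∀ {v} → v ≢ root → unfold v ≡ next v (unfold (parent v))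
    unfold-parent {v} v≢ = cong (λ d → go d v) (depth-parent v≢)

  module _ (f : Fin n → ℕ) where
    private
      go : ℕ → Fin n → Tree
      go zero    v = node 0 []
      go (suc h) v = mk (f v) (map (go h) (children v))

    abstract

      -- Canonical form of the subtree at v coloured by `f`: codes agree exactly when the coloured
      -- subtrees are isomorphic. The fuel `D ∸ depth v` is always positive, so the default
      -- `node 0 []` is never reached.
      code : Fin n → Tree
      code v = go (D ∸ depth v) v

      code-children : ∀ v → code v ≡ mk (f v) (map code (children v))
      code-children v = trans (cong (λ h → go h v) (+-∸-assoc 1 (depth<D v)))
        (cong (mk (f v)) (map-cong-local (All.tabulate λ {w} w∈ → cong (λ d → go (D ∸ d) w) (sym (depth-child w∈)))))

  module _ (L : Fin n → List ℕ) where

    -- Good v y: y codes a proper L-colouring of the subtree at v in which siblings always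
    -- have non-isomorphic coloured subtrees.
    data Good (v : Fin n) : Tree → Set where
      good : ∀ {c} → c ∈ L v → (g : Fin n → Tree) →
             (∀ {w} → w ∈ children v → label (g w) ≢ c × Good w (g w)) →
             Unique (map g (children v)) → Good v (mk c (map g (children v)))

    -- The global form of `Good`: one function gives the code at every vertex, and `label ∘ Y` is
    -- the colouring.
    record GoodColouring (Y : Fin n → Tree) : Set where
      field
        colour∈  : ∀ v → label (Y v) ∈ L v
        subtree  : ∀ v → Y v ≡ mk (label (Y v)) (map Y (children v))
        distinct : ∀ v → Unique (map Y (children v))
        proper   : ∀ {v w} → w ∈ children v → label (Y w) ≢ label (Y v)

    -- The derivation is unfolded from the root downwards, each child receiving the code and the
    -- subderivation stored at its parent. A state carries its own vertex, since only `state-vertex`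
    -- shows that the state reached at v belongs to v.
    goodColouring : ∀ {y} → Good root y → ∃ GoodColouring
    goodColouring {y} γ = Y , record { colour∈ = colour∈ ; subtree = subtree ; distinct = distinct ; proper = λ {v} → proper v }
      where
      State : Set
      State = Σ[ v ∈ Fin n ] Σ[ y ∈ Tree ] Good v y
      open DecMembership Fin._≟_ using (_∈?_)
      next : Fin n → State → State
      next w s@(v , _ , good _ g h _) with w ∈? children v
      ... | yes w∈ = w , g w , proj₂ (h w∈)
      -- A mere default: along `state`, the incoming state belongs to the parent of w.
      ... | no _   = s
      state : Fin n → State
      state = unfold (root , y , γ) next
      Y : Fin n → Tree
      Y v = proj₁ (proj₂ (state v))
      next-≡ : ∀ {w v y} (γ : Good v y) → w ∈ children v → proj₁ (next w (v , y , γ)) ≡ w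
      next-≡ {w} {v} (good _ g h _) w∈ with w ∈? children v
      ... | yes _ = refl
      ... | no w∉ = ⊥-elim (w∉ w∈)
      next-code : ∀ {w v c} (c∈ : c ∈ L v) (g : Fin n → Tree) (h : ∀ {w} → w ∈ children v → label (g w) ≢ c × Good w (g w))
                  (u : Unique (map g (children v))) → w ∈ children v →
                  proj₁ (proj₂ (next w (v , _ , good {c = c} c∈ g h u))) ≡ g w
      next-code {w} {v} c∈ g h u w∈ with w ∈? children v
      ... | yes _ = refl
      ... | no w∉ = ⊥-elim (w∉ w∈)
      state-vertex : ∀ v → proj₁ (state v) ≡ v
      state-vertex = top-down _ (cong proj₁ (unfold-root _ next)) λ {v} v≢ ih →
        trans (cong proj₁ (unfold-parent _ next v≢)) (next-at v≢ ih)
        where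
        next-at : ∀ {v} → v ≢ root → proj₁ (state (parent v)) ≡ parent v → proj₁ (next v (state (parent v))) ≡ v
        next-at {v} v≢ ih with state (parent v)
        ... | _ , _ , γ = next-≡ γ (∈-children⁺ (v≢ , sym ih))
      Y-child : ∀ {v w} → w ∈ children v → Y w ≡ proj₁ (proj₂ (next w (state v)))
      Y-child w∈ with w≢ , refl ← ∈-children⁻ w∈ = cong (proj₁ ∘ proj₂) (unfold-parent _ next w≢)
      record Local (v : Fin n) (y : Tree) : Set where
        field
          colour∈  : label y ∈ L v
          subtree  : y ≡ mk (label y) (map Y (children v))
          distinct : Unique (map Y (children v))
          proper   : ∀ {w} → w ∈ children v → label (Y w) ≢ label y
      local : ∀ v → Local v (Y v)
      local v = go (state v) (state-vertex v) Y-child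
        where
        go : ∀ (s : State) → proj₁ s ≡ v → (∀ {w} → w ∈ children v → Y w ≡ proj₁ (proj₂ (next w s))) →
             Local v (proj₁ (proj₂ s))
        go (v , _ , good {c = c} c∈ g h u) refl Yw = record
          { colour∈ = c∈
          ; subtree = cong (mk c) (sym map-Y)
          ; distinct = subst Unique (sym map-Y) u
          ; proper = λ w∈ e → proj₁ (h w∈) (trans (cong label (sym (Y≡g w∈))) e) }
          where
          Y≡g : ∀ {w} → w ∈ children v → Y w ≡ g w
          Y≡g w∈ = trans (Yw w∈) (next-code c∈ g h u w∈)
          map-Y : map Y (children v) ≡ map g (children v)
          map-Y = map-cong-local (All.tabulate Y≡g)
      open module Local′ v = Local (local v)

  -- Counting good codes by isomorphism type.

  module Counting (k : ℕ) where

    -- There are `pred k` colours other than the parent's, and `a` codes for each.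
    candidateCount : Tree → ℕ
    candidateCount (node a _) = pred k * a

    -- The label of a type is the number of good codes of that type with a prescribed root colour
    -- when all lists are {0, …, k − 1}.
    typeOf : List Tree → Tree
    typeOf τs = node (transversals candidateCount (sort τs)) (sort τs)

    type  : Tree → Tree
    types : List Tree → List Tree
    type (node _ ts) = typeOf (types ts)
    types []       = []
    types (t ∷ ts) = type t ∷ types ts

    types≡map : ∀ ts → types ts ≡ map type ts
    types≡map []       = refl
    types≡map (t ∷ ts) = cong (type t ∷_) (types≡map ts)

    typeOf-cong-↭ : ∀ {σs τs} → σs ↭ τs → typeOf σs ≡ typeOf τs
    typeOf-cong-↭ p = cong (λ τs → node (transversals candidateCount τs) τs) (sort-cong-↭ p)

    typeOf-injective : ∀ {σs τs} → typeOf σs ≡ typeOf τs → σs ↭ τs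
    -- Writing 0 for the counts at the root turns both sides into values of `mk 0`.
    typeOf-injective {σs} {τs} e = proj₂ (mk-injective (cong (λ { (node _ ts) → node 0 ts }) e))

    type-mk : ∀ c ts → type (mk c ts) ≡ typeOf (map type ts)
    type-mk c ts = trans (cong typeOf (types≡map (sort ts))) (typeOf-cong-↭ (Perm.map⁺ type (sort-↭ ts)))

    -- Any colouring would give the same tree, since `type` discards colours.
    vertexType : Fin n → Tree
    vertexType v = type (code (λ _ → 0) v)

    vertexType-children : ∀ v → vertexType v ≡ typeOf (map vertexType (children v))
    vertexType-children v = trans (cong type (code-children (λ _ → 0) v))
      (trans (type-mk 0 (map (code _) (children v))) (cong typeOf (sym (map-∘ (children v)))))

    good-type : ∀ {L v y} → Good L v y → type y ≡ vertexType v
    good-type {v = v} (good {c} _ g h _) = begin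
      type (mk c (map g (children v)))       ≡⟨ type-mk c (map g (children v)) ⟩
      typeOf (map type (map g (children v))) ≡⟨ cong typeOf (map-∘ (children v)) ⟨
      typeOf (map (type ∘ g) (children v))   ≡⟨ cong typeOf (map-cong-local (All.tabulate λ w∈ → good-type (proj₂ (h w∈)))) ⟩
      typeOf (map vertexType (children v))   ≡⟨ vertexType-children v ⟨
      vertexType v                           ∎
      where open ≡-Reasoning

    open Transversals type

    module _ {L : Fin n → List ℕ} (L-unique : ∀ v → Unique (L v)) (L-size : ∀ v → k ≤ length (L v)) where

      ManyGood : Fin n → Set
      ManyGood v = ∀ {c} → c ∈ L v → ∃ λ R →
        Unique R × (∀ {y} → y ∈ R → Good L v y × label y ≡ c) × label (vertexType v) ≤ length R

      -- By induction a child w has at least `pred k * label (vertexType w)` good codes with root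
      -- colour other than c. A transversal of these sets gives the children distinct codes, and
      -- inequivalent transversals give different codes at v.
      many-good : ∀ v → ManyGood v
      many-good = bottom-up ManyGood ind
        where
        open Delete _≟_
        ind : ∀ v → (∀ {w} → w ∈ children v → ManyGood w) → ManyGood v
        ind v ih {c} c∈ = map (mk c) family , AllPairs.map⁺ (AllPairs.map (λ ≁ e → ≁ (proj₂ (mk-injective e))) inequivalent)
          , sound , ≤-trans (≤-reflexive (cong label (vertexType-children v))) (≤-trans size (≤-reflexive (sym (length-map (mk c) family))))
          where
          τs : List Tree
          τs = sort (map vertexType (children v))
          -- The children are reordered to follow the sorted list of types on which the count is
          -- computed.
          arranged : ∃ λ ws → τs ≡ map vertexType ws × children v ↭ ws
          arranged = ↭-map-inv vertexType (↭-sym (sort-↭ _))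
          ws : List (Fin n)
          ws = proj₁ arranged
          ch↭ws : children v ↭ ws
          ch↭ws = proj₂ (proj₂ arranged)
          options : ∀ {w} → w ∈ ws → ∃ λ R → Unique R × (∀ {y} → y ∈ R → ∃ λ d → d ∈ delete c (L w) × Good L w y × label y ≡ d)
                      × length (delete c (L w)) * label (vertexType w) ≤ length R
          options {w} w∈ = disjoint-union (λ d y → Good L w y × label y ≡ d) (λ p q → trans (sym (proj₂ p)) (proj₂ q))
            (delete-unique (L-unique w)) (λ d∈ → ih (∈-resp-↭ (↭-sym ch↭ws) w∈) (proj₁ (∈-delete⁻ {xs = L w} d∈)))
          Option : Fin n → Tree → Set
          Option w y = label y ≢ c × Good L w y
          choices : ∀ us → (∀ {w} → w ∈ us → w ∈ ws) → ∃ λ Ss → Pointwise (Candidates candidateCount) (map vertexType us) Ss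
                      × (∀ {ys} → Pointwise _∈_ ys Ss → Pointwise Option us ys)
          choices []       _  = [] , [] , λ { [] → [] }
          choices (w ∷ us) us⊆ with R , u , q , s ← options (us⊆ (here refl)) | Ss , cs , opt ← choices us (us⊆ ∘ there)
            = R ∷ Ss , candidates u (λ y∈ → good-type (proj₁ (proj₂ (proj₂ (q y∈))))) size ∷ cs
            , λ { (y∈ ∷ ys∈) → option (q y∈) ∷ opt ys∈ }
            where
            option : ∀ {y} → (∃ λ d → d ∈ delete c (L w) × Good L w y × label y ≡ d) → Option w y
            option (_ , d∈ , γ , refl) = proj₂ (∈-delete⁻ {xs = L w} d∈) , γ
            size : candidateCount (vertexType w) ≤ length R
            size with vertexType w
            -- Deleting c leaves at least `pred k` colours, whether or not c occurs in `L w`.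
            ... | node a _ = ≤-trans (*-monoˡ-≤ a (pred-mono-≤ (≤-trans (L-size w) (length-delete-unique c (L-unique w))))) s
          chosen : ∃ λ Ss → Pointwise (Candidates candidateCount) (map vertexType ws) Ss
                     × (∀ {ys} → Pointwise _∈_ ys Ss → Pointwise Option ws ys)
          chosen = choices ws id
          open Lower (lower-transversals candidateCount 
            (subst (λ us → Pointwise (Candidates candidateCount) us (proj₁ chosen)) (sym (proj₁ (proj₂ arranged))) (proj₁ (proj₂ chosen))))
          sound : ∀ {y} → y ∈ map (mk c) family → Good L v y × label y ≡ c
          sound y∈ with ys , ys∈ , refl ← ∈-map⁻ (mk c) y∈
            with tr , u ← All.lookup transversal ys∈
            with g , refl , opt ← interpolate Fin._≟_ (node 0 []) (unique-resp-↭ ch↭ws (children-unique v)) (proj₂ (proj₂ chosen) tr)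
            = subst (Good L v) (mk-cong-↭ c g-ch) (good c∈ g (opt ∘ ∈-resp-↭ ch↭ws) (unique-resp-↭ (↭-sym g-ch) u)) , refl
            where
            g-ch : map g (children v) ↭ map g ws
            g-ch = Perm.map⁺ g ch↭ws

    uniform : Fin n → List ℕ
    uniform _ = upTo k

    -- The list has to contain codes that are good at any vertex w of the type of v, because one
    -- list must serve all siblings of that type at once.
    FewGood : Fin n → Set
    FewGood v = ∀ {c} → c ∈ upTo k → ∃ λ U →
      (∀ {y w} → Good uniform w y → type y ≡ vertexType v → label y ≡ c → y ∈ U) × length U ≤ label (vertexType v)

    -- A good code with root colour c is `mk c` of a duplicate-free list of codes with known types
    -- and root colours other than c. `upper-transversals` bounds the number of such lists up to
    -- order.
    few-good : ∀ v → FewGood v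
    few-good = bottom-up FewGood ind
      where
      open Delete _≟_
      ind : ∀ v → (∀ {u} → u ∈ children v → FewGood u) → FewGood v
      ind v ih {c} c∈ = map (mk c) family , covered
        , ≤-trans (≤-reflexive (length-map (mk c) family)) (≤-trans size (≤-reflexive (sym (cong label (vertexType-children v)))))
        where
        τs : List Tree
        τs = sort (map vertexType (children v))
        Option : Tree → Set
        Option y = (∃ λ w → Good uniform w y) × label y ≢ c
        covers : ∀ {τ} → τ ∈ τs → Cover Option τ (candidateCount τ)
        covers τ∈ with u , u∈ , refl ← ∈-map⁻ vertexType (∈-resp-↭ (sort-↭ _) τ∈)
          with U , comp , s ← union-cover (λ d y → (∃ λ w → Good uniform w y) × type y ≡ vertexType u × label y ≡ d) (delete c (upTo k))
                 (λ d∈ → let U , comp , s = ih u∈ (proj₁ (∈-delete⁻ {xs = upTo k} d∈)) in U , (λ { ((_ , γ) , t , l) → comp γ t l }) , s)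
          -- `U` may hold codes of other types, which `Cover` forbids.
          = cover (filter (λ y → type y ≟ᵗ vertexType u) U)
              (λ y∈ → proj₂ (∈-filter⁻ (λ y → type y ≟ᵗ vertexType u) {xs = U} y∈))
              (λ { ((w , γ) , ≢c) t → ∈-filter⁺ (λ y → type y ≟ᵗ vertexType u) (comp (∈-delete⁺ (colour∈ γ) ≢c) ((w , γ) , t , refl)) t })
              (≤-trans (length-filter _ U) (≤-trans s count))
          where
          colour∈ : ∀ {w y} → Good uniform w y → label y ∈ upTo k
          colour∈ (good d∈ _ _ _) = d∈
          count : length (delete c (upTo k)) * label (vertexType u) ≤ candidateCount (vertexType u)
          count with vertexType u
          ... | node a _ = *-monoˡ-≤ a (pred-mono-≤ (≤-trans (length-delete-∈ c∈) (≤-reflexive (length-upTo k))))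
        open Upper (upper-transversals candidateCount τs covers)
        covered : ∀ {y w} → Good uniform w y → type y ≡ vertexType v → label y ≡ c → y ∈ map (mk c) family
        covered {w = w} (good _ g h u) t refl =
          let zs , zs∈ , p = complete {map g (children w)} (All.map⁺ (All.tabulate λ x∈ → (-, proj₂ (h x∈)) , proj₁ (h x∈))) u
                (↭-trans (typeOf-injective (trans (sym (type-mk c (map g (children w)))) (trans t (vertexType-children v))))
                  (↭-sym (sort-↭ _)))
          in subst (_∈ map (mk c) family) (sym (mk-cong-↭ c p)) (∈-map⁺ (mk c) zs∈)

    -- By `few-good`, a single good code for the uniform lists makes the count of its type positive;
    -- by `many-good`, a positive count yields a good code for `L`.
    list-good : ∀ {L : Fin n → List ℕ} → (∀ v → Unique (L v)) → (∀ v → k ≤ length (L v)) → ∀ {v y} →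
                Good uniform v y → ∃ (Good L v)
    list-good {L} L-unique L-size {v} γ@(good c∈ _ _ _) =
      let _ , d∈ = nonempty (≤-trans k>0 (L-size v))
          _ , _ , sound , s = many-good L-unique L-size v d∈
          y , y∈ = nonempty (≤-trans count>0 s)
      in y , proj₁ (sound y∈)
      where
      positive : ∀ {A : Set} {x : A} {xs} → x ∈ xs → 1 ≤ length xs
      positive (here _)  = s≤s z≤n
      positive (there _) = s≤s z≤n
      k>0 : 1 ≤ k
      k>0 = ≤-trans (positive c∈) (≤-reflexive (length-upTo k))
      count>0 : 1 ≤ label (vertexType v)
      count>0 = let U , comp , s = few-good v c∈ in ≤-trans (positive (comp γ (good-type γ) refl)) s
      nonempty : ∀ {A : Set} {xs : List A} → 1 ≤ length xs → ∃ (_∈ xs)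
      nonempty {xs = x ∷ _} _ = x , here refl

-- Automorphisms of a rooted tree

-- Punching out a missed value would leave an injection of `Fin (suc n)` into `Fin n`.
injective⇒surjective : ∀ {n} (σ : Fin n → Fin n) → (∀ {u v} → σ u ≡ σ v → u ≡ v) → ∀ y → ∃ λ x → σ x ≡ y
injective⇒surjective {suc n} σ inj y with Fin.any? (λ x → σ x Fin.≟ y)
... | yes hit = hit
... | no miss = ⊥-elim (1+n≰n (Fin.injective⇒≤ {f = λ x → punchOut (λ e → miss (x , sym e))}
                  (λ e → inj (Fin.punchOut-injective (λ e → miss (_ , sym e)) (λ e → miss (_ , sym e)) e))))

injective⇒permutation : ∀ {n} (σ : Fin n → Fin n) → (∀ {u v} → σ u ≡ σ v → u ≡ v) → Σ[ π ∈ Permutation′ n ] ∀ v → π ⟨$⟩ʳ v ≡ σ v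
injective⇒permutation σ inj = permutation σ (proj₁ ∘ surj) (proj₂ ∘ surj) (λ x → inj (proj₂ (surj (σ x)))) , λ _ → refl
  where
  surj : ∀ y → ∃ λ x → σ x ≡ y
  surj = injective⇒surjective σ inj

transpose-elim : ∀ {n} {i j : Fin n} (P : Fin n → Fin n → Set) → P i j → P j i →
                 (∀ {k} → k ≢ i → k ≢ j → P k k) → ∀ k → P k (transpose i j k)
transpose-elim {i = i} {j} P pi pj pk k with k Fin.≟ i
... | yes refl = pi
... | no k≢i with k Fin.≟ j
...   | yes refl = pj
...   | no k≢j = pk k≢i k≢j

transpose-injective : ∀ {n} (i j : Fin n) {k l} → transpose i j k ≡ transpose i j l → k ≡ l
transpose-injective i j e = trans (sym (transpose-inverse j i)) (trans (cong (transpose j i) e) (transpose-inverse j i))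

map-≡⇒Pointwise : ∀ {A B : Set} {g : A → B} {xs ys} → map g xs ≡ map g ys → Pointwise (λ x y → g x ≡ g y) xs ys
map-≡⇒Pointwise {xs = []}    {[]}    _ = []
map-≡⇒Pointwise {xs = _ ∷ _} {_ ∷ _} e with e₁ , e₂ ← ∷-injective e = e₁ ∷ map-≡⇒Pointwise e₂

module RootedGraph {n : ℕ} (G : Graph n) (root : Fin n) (parent : Fin n → Fin n) (depth : Fin n → ℕ)
  (depth-root : depth root ≡ 0) (depth-parent : ∀ {v} → v ≢ root → depth v ≡ suc (depth (parent v)))
  (adj-parent : ∀ {v} → v ≢ root → Graph.Adj G v (parent v))
  (edge : ∀ {u v} → Graph.Adj G u v → (u ≢ root × parent u ≡ v) ⊎ (v ≢ root × parent v ≡ u)) where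

  open Graph G using (Adj) renaming (sym to Adj-sym)
  open RootedTree root parent depth depth-root depth-parent

  module _ (f : Fin n → ℕ) (dist : Distinguishing G f) {p u w : Fin n}
    (u∈ : u ∈ children p) (w∈ : w ∈ children p) (same : code f u ≡ code f w) where

    private
      -- One level of the automorphism built below. Injectivity suffices, as finiteness makes the
      -- resulting injection a permutation.
      record Matching (a b : Fin n) : Set where
        field
          fun       : Fin n → Fin n
          child     : ∀ {z} → z ∈ children a → fun z ∈ children b
          same-code : ∀ {z} → z ∈ children a → code f (fun z) ≡ code f z
          injective : ∀ {y z} → y ∈ children a → z ∈ children a → fun y ≡ fun z → y ≡ z

      -- When a is not p, neither u nor w is a child of a and the transposition fixes all its
      -- children.
      swap-matching : ∀ a → Matching a a
      swap-matching a = record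
        { fun = transpose u w
        ; child = λ {z} → transpose-elim (λ z z′ → z ∈ children a → z′ ∈ children a) (move u∈ w∈) (move w∈ u∈) (λ _ _ → id) z
        ; same-code = λ {z} _ → transpose-elim (λ z z′ → code f z′ ≡ code f z) (sym same) same (λ _ _ → refl) z
        ; injective = λ _ _ → transpose-injective u w }
        where
        move : ∀ {x y} → x ∈ children p → y ∈ children p → x ∈ children a → y ∈ children a
        move x∈ y∈ x∈′ = subst (λ q → _ ∈ children q) (trans (sym (proj₂ (∈-children⁻ x∈))) (proj₂ (∈-children⁻ x∈′))) y∈

      -- Equal codes have the same multiset of child codes, so the children of b can be listed as
      -- `zs` with codes equal, entry by entry, to those of the children of a.
      iso-matching : ∀ a b → code f a ≡ code f b → Matching a b
      iso-matching a b e
        with zs , e′ , p′ ← ↭-map-inv (code f)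
               (↭-sym (proj₂ (mk-injective (trans (sym (code-children f a)) (trans e (code-children f b))))))
        with g , refl , rel ← interpolate Fin._≟_ a (children-unique a) (map-≡⇒Pointwise e′) = record
        { fun = g
        ; child = λ z∈ → ∈-resp-↭ (↭-sym p′) (∈-map⁺ g z∈)
        ; same-code = sym ∘ rel
        ; injective = unique-map⇒injective g (unique-resp-↭ p′ (children-unique b)) }

      matching : ∀ a b → code f a ≡ code f b → Matching a b
      matching a b e with a Fin.≟ b
      ... | yes refl = swap-matching a
      ... | no _     = iso-matching a b e

      -- Deciding the equality of codes here makes this a plain function of vertices, as `unfold`
      -- requires.
      match : Fin n → Fin n → Fin n → Fin n
      match a b z with code f a ≟ᵗ code f b
      ... | yes e = Matching.fun (matching a b e) z
      ... | no _  = z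

      match-self : ∀ a z → match a a z ≡ transpose u w z
      match-self a z with code f a ≟ᵗ code f a
      ... | no ≢ = ⊥-elim (≢ refl)
      ... | yes e with a Fin.≟ a
      ...   | yes refl = refl
      ...   | no ≢     = ⊥-elim (≢ refl)

      match-child : ∀ {a b z} → code f a ≡ code f b → z ∈ children a →
                    match a b z ∈ children b × code f (match a b z) ≡ code f z
      match-child {a} {b} e z∈ with code f a ≟ᵗ code f b
      ... | no ≢   = ⊥-elim (≢ e)
      ... | yes e′ = Matching.child (matching a b e′) z∈ , Matching.same-code (matching a b e′) z∈

      match-injective : ∀ {a b y z} → code f a ≡ code f b → y ∈ children a → z ∈ children a →
                        match a b y ≡ match a b z → y ≡ z
      match-injective {a} {b} e y∈ z∈ with code f a ≟ᵗ code f b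
      ... | no ≢   = ⊥-elim (≢ e)
      ... | yes e′ = Matching.injective (matching a b e′) y∈ z∈

      move : Fin n → Fin n → Fin n
      move z b = match (parent z) b z

      -- Built from the root downwards: once a goes to a vertex b with the same code, the children of a
      -- are matched with those of b. The identity is chosen wherever a is fixed, except that u and w
      -- are exchanged.
      σ : Fin n → Fin n
      σ = unfold root move

      move-child : ∀ {z b} → z ≢ root → code f (parent z) ≡ code f b → move z b ∈ children b × code f (move z b) ≡ code f z
      move-child z≢ e = match-child e (∈-children⁺ (z≢ , refl))

      σ-root : σ root ≡ root
      σ-root = unfold-root root move

      σ-parent : ∀ {v} → v ≢ root → σ v ≡ move v (σ (parent v))
      σ-parent = unfold-parent root move

      σ-code : ∀ v → code f (σ v) ≡ code f v
      σ-code = top-down _ (cong (code f) σ-root) λ v≢ ih →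
        trans (cong (code f) (σ-parent v≢)) (proj₂ (move-child v≢ (sym ih)))

      σ-child : ∀ {v} → v ≢ root → Child (σ (parent v)) (σ v)
      σ-child {v} v≢ = ∈-children⁻ (subst (_∈ children (σ (parent v))) (sym (σ-parent v≢)) (proj₁ (move-child v≢ (sym (σ-code _)))))

      -- `σ` commutes with `parent`, so equal images come from vertices whose parents have equal
      -- images. The parents coincide by induction, and `match` is injective on siblings.
      σ-injective : ∀ v {v′} → σ v ≡ σ v′ → v ≡ v′
      σ-injective = top-down (λ v → ∀ {v′} → σ v ≡ σ v′ → v ≡ v′) base ind
        where
        base : ∀ {v′} → σ root ≡ σ v′ → root ≡ v′
        base {v′} e with v′ Fin.≟ root
        ... | yes refl = refl
        ... | no v′≢   = ⊥-elim (proj₁ (σ-child v′≢) (trans (sym e) σ-root))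
        ind : ∀ {v} → v ≢ root → (∀ {v′} → σ (parent v) ≡ σ v′ → parent v ≡ v′) → ∀ {v′} → σ v ≡ σ v′ → v ≡ v′
        ind {v} v≢ ih {v′} e with v′ Fin.≟ root
        ... | yes refl = ⊥-elim (proj₁ (σ-child v≢) (trans e σ-root))
        ... | no v′≢   = match-injective (sym (σ-code (parent v))) (∈-children⁺ (v≢ , refl)) (∈-children⁺ (v′≢ , sym ≡p))
          (trans (sym (σ-parent v≢)) (trans e (trans (σ-parent v′≢) (cong (λ q → match q (σ q) v′) (sym ≡p)))))
          where
          ≡p : parent v ≡ parent v′
          ≡p = ih (trans (sym (proj₂ (σ-child v≢))) (trans (cong parent e) (proj₂ (σ-child v′≢))))

      σ-adj : ∀ {a b} → a ≢ root → parent a ≡ b → Adj (σ a) (σ b)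
      σ-adj a≢ refl = subst (Adj _) (proj₂ (σ-child a≢)) (adj-parent (proj₁ (σ-child a≢)))

      σ-adj⁻ : ∀ {a b} → σ a ≢ root → parent (σ a) ≡ σ b → Adj a b
      σ-adj⁻ {a} σa≢ e with a Fin.≟ root
      ... | yes refl = ⊥-elim (σa≢ σ-root)
      ... | no a≢ = subst (Adj a) (σ-injective _ (trans (sym (proj₂ (σ-child a≢))) e)) (adj-parent a≢)

      σ-automorphism : ∀ a b → Adj a b ⇔ Adj (σ a) (σ b)
      σ-automorphism a b = mk⇔
        (λ ab → [ (λ (a≢ , e) → σ-adj a≢ e) , (λ (b≢ , e) → Adj-sym (σ-adj b≢ e)) ]′ (edge ab))
        (λ ab → [ (λ (a≢ , e) → σ-adj⁻ a≢ e) , (λ (b≢ , e) → Adj-sym (σ-adj⁻ b≢ e)) ]′ (edge ab))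

      σ-colour : ∀ v → f (σ v) ≡ f v
      σ-colour v = proj₁ (mk-injective (trans (sym (code-children f (σ v))) (trans (σ-code v) (code-children f v))))

      -- Children of a fixed vertex are fixed except for u and w, which lie one level below p.
      σ-fixes-above : ∀ v → depth v ≤ depth p → σ v ≡ v
      σ-fixes-above = top-down _ (λ _ → σ-root) λ {v} v≢ ih v≤ → begin
        σ v                   ≡⟨ σ-parent v≢ ⟩
        move v (σ (parent v)) ≡⟨ cong (move v) (ih (≤-trans (n≤1+n _) (≤-trans (≤-reflexive (sym (depth-parent v≢))) v≤))) ⟩
        move v (parent v)     ≡⟨ match-self (parent v) v ⟩
        transpose u w v       ≡⟨ transpose-elim (λ z z′ → depth z ≤ depth p → z′ ≡ z) (too-deep u∈) (too-deep w∈) (λ _ _ _ → refl) v v≤ ⟩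
        v                     ∎
        where
        open ≡-Reasoning
        too-deep : ∀ {z z′} → z ∈ children p → depth z ≤ depth p → z′ ≡ z
        too-deep z∈ z≤ = ⊥-elim (1+n≰n (subst (_≤ depth p) (depth-child z∈) z≤))

      σ-swaps : σ u ≡ w
      σ-swaps with u≢ , refl ← ∈-children⁻ u∈ = begin
        σ u                   ≡⟨ σ-parent u≢ ⟩
        move u (σ (parent u)) ≡⟨ cong (move u) (σ-fixes-above p ≤-refl) ⟩
        move u (parent u)     ≡⟨ match-self (parent u) u ⟩
        transpose u w u       ≡⟨ transpose-elim (λ z z′ → z ≡ u → z′ ≡ w) (λ _ → refl) sym (λ z≢ _ z≡ → ⊥-elim (z≢ z≡)) u refl ⟩
        w                     ∎
        where open ≡-Reasoning

    -- `σ` preserves colours, so `dist` makes it the identity, yet it sends u to w.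
    same-code⇒≡ : u ≡ w
    same-code⇒≡ with π , π≡σ ← injective⇒permutation σ (σ-injective _) =
      trans (sym (dist π automorphism (λ v → trans (cong f (π≡σ v)) (σ-colour v)) u)) (trans (π≡σ u) σ-swaps)
      where
      automorphism : IsAutomorphism G π
      automorphism a b = subst₂ (λ x y → Adj a b ⇔ Adj x y) (sym (π≡σ a)) (sym (π≡σ b)) (σ-automorphism a b)

  distinguishing⇒good : ∀ {L f} → (∀ v → f v ∈ L v) → Proper G f → Distinguishing G f → ∀ v → Good L v (code f v)
  distinguishing⇒good {L} {f} f∈ prop dist = bottom-up _ λ v ih →
    subst (Good L v) (sym (code-children f v))
      (good (f∈ v) (code f) (λ {w} w∈ → (λ e → colour-≢ w∈ (trans (sym (label-code w)) e)) , ih w∈)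
        (injective⇒unique-map (code f) (children-unique v) (same-code⇒≡ f dist)))
    where
    label-code : ∀ v → label (code f v) ≡ f v
    label-code v = cong label (code-children f v)
    colour-≢ : ∀ {v w} → w ∈ children v → f w ≢ f v
    colour-≢ w∈ with w≢ , refl ← ∈-children⁻ w∈ = prop _ _ (adj-parent w≢)

  module _ {L : Fin n → List ℕ} {Y : Fin n → Tree} (Y-good : GoodColouring L Y) where
    open GoodColouring Y-good

    goodColouring-proper : Proper G (label ∘ Y)
    goodColouring-proper u v uv =
      [ (λ (u≢ , e) → proper (∈-children⁺ (u≢ , e)))
      , (λ (v≢ , e) → proper (∈-children⁺ (v≢ , e)) ∘ sym) ]′ (edge uv)

    -- From the leaves upwards, the automorphism preserves the codes `Y`. From the root downwards,
    -- once the parent of v is fixed, v and its image are siblings with equal codes, hence equal.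
    goodColouring-rigid : ∀ σ → IsAutomorphism G σ → σ ⟨$⟩ʳ root ≡ root → (∀ v → depth (σ ⟨$⟩ʳ v) ≡ depth v) →
                          (∀ v → label (Y (σ ⟨$⟩ʳ v)) ≡ label (Y v)) → ∀ v → σ ⟨$⟩ʳ v ≡ v
    goodColouring-rigid π aut σ-root σ-depth σ-colour = top-down _ σ-root λ {v} v≢ ih →
      unique-map⇒injective Y (distinct (parent v)) (∈-children⁺ (σ-≢root v≢ , trans (σ-parent v≢) ih)) (∈-children⁺ (v≢ , refl)) (σ-code v)
      where
      σ : Fin n → Fin n
      σ = π ⟨$⟩ʳ_
      σ-injective : ∀ {u v} → σ u ≡ σ v → u ≡ v
      σ-injective e = trans (sym (inverseˡ π)) (trans (cong (π ⟨$⟩ˡ_) e) (inverseˡ π))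
      σ-≢root : ∀ {v} → v ≢ root → σ v ≢ root
      σ-≢root v≢ e = v≢ (σ-injective (trans e (sym σ-root)))
      σ-parent : ∀ {v} → v ≢ root → parent (σ v) ≡ σ (parent v)
      σ-parent {v} v≢ with edge (Equivalence.to (aut v (parent v)) (adj-parent v≢))
      ... | inj₁ (_ , e) = e
      -- Here `σ (parent v)` would be a child of `σ v` and so two levels deeper than `parent v`.
      ... | inj₂ (σp≢ , e) = ⊥-elim (<-asym (n<1+n (depth (parent v))) (≤-reflexive (begin
        suc (suc (depth (parent v)))          ≡⟨ cong suc (depth-parent v≢) ⟨
        suc (depth v)                         ≡⟨ cong suc (σ-depth v) ⟨
        suc (depth (σ v))                     ≡⟨ cong (suc ∘ depth) e ⟨
        suc (depth (parent (σ (parent v))))   ≡⟨ depth-parent σp≢ ⟨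
        depth (σ (parent v))                  ≡⟨ σ-depth (parent v) ⟩
        depth (parent v)                      ∎)))
        where open ≡-Reasoning
      children-σ : ∀ v → children (σ v) ↭ map σ (children v)
      children-σ v = ∼bag⇒↭ (unique∧set⇒bag (children-unique (σ v)) (Unique.map⁺ σ-injective (children-unique v)) (mk⇔ to from))
        where
        to : ∀ {w} → w ∈ children (σ v) → w ∈ map σ (children v)
        to {w} w∈ with w≢ , e ← ∈-children⁻ w∈ = subst (_∈ map σ (children v)) (inverseʳ π) (∈-map⁺ σ (∈-children⁺ (w′≢ ,
            σ-injective (trans (sym (σ-parent w′≢)) (trans (cong parent (inverseʳ π)) e)))))
          where
          w′≢ : π ⟨$⟩ˡ w ≢ root
          w′≢ e′ = w≢ (trans (sym (inverseʳ π)) (trans (cong σ e′) σ-root))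
        from : ∀ {w} → w ∈ map σ (children v) → w ∈ children (σ v)
        from w∈ with z , z∈ , refl ← ∈-map⁻ σ w∈ with z≢ , refl ← ∈-children⁻ z∈ = ∈-children⁺ (σ-≢root z≢ , σ-parent z≢)
      σ-code : ∀ v → Y (σ v) ≡ Y v
      σ-code = bottom-up _ λ v ih → begin
        Y (σ v)                                          ≡⟨ subtree (σ v) ⟩
        mk (label (Y (σ v))) (map Y (children (σ v)))    ≡⟨ cong (λ c → mk c (map Y (children (σ v)))) (σ-colour v) ⟩
        mk (label (Y v)) (map Y (children (σ v)))        ≡⟨ mk-cong-↭ _ (Perm.map⁺ Y (children-σ v)) ⟩
        mk (label (Y v)) (map Y (map σ (children v)))    ≡⟨ cong (mk _) (map-∘ (children v)) ⟨
        mk (label (Y v)) (map (Y ∘ σ) (children v))      ≡⟨ cong (mk _) (map-cong-local (All.tabulate ih)) ⟩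
        mk (label (Y v)) (map Y (children v))            ≡⟨ subtree v ⟨
        Y v                                              ∎
        where open ≡-Reasoning

-- Distances and the centre

least : ∀ {P : ℕ → Set} → Decidable P → ∀ {m} → P m → ∃ λ d → P d × (∀ {j} → P j → d ≤ j)
least {P} P? {m} pm with P? 0
... | yes p0 = 0 , p0 , λ _ → z≤n
least {P} P? {zero}  pm | no ¬p0 = ⊥-elim (¬p0 pm)
least {P} P? {suc m} pm | no ¬p0 with d , pd , min ← least (P? ∘ suc) pm = suc d , pd , λ
  { {zero}  p → ⊥-elim (¬p0 p)
  ; {suc j} p → s≤s (min p) }

sum-mono-≤ : ∀ {n} {f g : Fin n → ℕ} → (∀ i → f i ≤ g i) → sum f ≤ sum g
sum-mono-≤ {zero}  f≤g = z≤n
sum-mono-≤ {suc n} f≤g = +-mono-≤ (f≤g zero) (sum-mono-≤ (f≤g ∘ suc))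

sum-mono-< : ∀ {n} {f g : Fin n → ℕ} → (∀ i → f i ≤ g i) → ∀ i → f i < g i → sum f < sum g
sum-mono-< f≤g zero    f<g = +-mono-<-≤ f<g (sum-mono-≤ (f≤g ∘ suc))
sum-mono-< f≤g (suc i) f<g = +-mono-≤-< (f≤g zero) (sum-mono-< (f≤g ∘ suc) i f<g)

-- Simple paths and acyclicity.

module SimplePaths {n : ℕ} (R : Fin n → Fin n → Set) where

  data Path : Fin n → List (Fin n) → Fin n → Set where
    end  : ∀ {v} → Path v [] v
    cons : ∀ {u w v ps} → R u w → u ∉ w ∷ ps → Path w ps v → Path u (w ∷ ps) v

  open DecMembership (Fin._≟_ {n}) using (_∈?_)

  suffix : ∀ {u w v ps} → Path w ps v → u ∈ w ∷ ps → ∃ λ qs → Path u qs v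
  suffix p            (here refl) = -, p
  suffix (cons _ _ p) (there u∈)  = suffix p u∈

  loop-erase : ∀ {u v} → Star R u v → ∃ λ ps → Path u ps v
  loop-erase ε = -, end
  loop-erase {u} (_◅_ {j = w} r rs) with ps , p ← loop-erase rs with u ∈? w ∷ ps
  ... | yes u∈ = suffix p u∈
  ... | no u∉  = -, cons r u∉ p

  path-unique : ∀ {u v ps} → Path u ps v → Unique (u ∷ ps)
  path-unique end          = [] ∷ []
  path-unique (cons _ u∉ p) = All.¬Any⇒All¬ _ u∉ ∷ path-unique p

module _ {n : ℕ} (G : Graph n) (acyclic : ¬ Cycle G) where
  open Graph G using (Adj) renaming (sym to Adj-sym; irrefl to Adj-irrefl)

  module _ {R : Fin n → Fin n → Set} (R⊆Adj : ∀ {u v} → R u v → Adj u v) where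
    open SimplePaths R

    private
      close : ∀ {u v x ps} → Path u ps v → Adj v x → Linked Adj (u ∷ ps ++ [ x ])
      close end            vx = vx ∷ [-]
      close (cons r _ p) vx = R⊆Adj r ∷ close p vx

    -- A simple path of length at least two joining u and v would close up with an edge uv to a cycle.
    walk-or-nonadjacent : ∀ {u v} → Star R u v → R u v ⊎ ¬ Adj u v
    walk-or-nonadjacent rs with loop-erase rs
    ... | _ , end = inj₂ Adj-irrefl
    ... | _ , cons r _ end = inj₁ r
    ... | _ , p@(cons _ _ (cons _ _ _)) = inj₂ λ uv → acyclic (-, -, s≤s (s≤s z≤n) , path-unique p , close p (Adj-sym uv))

module TreeMetric {n : ℕ} (G : Graph n) (connected : Connected G) (acyclic : ¬ Cycle G) where
  open Graph G using (Adj) renaming (sym to Adj-sym; irrefl to Adj-irrefl)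

  -- Connectedness supplies a walk, and `walk-or-nonadjacent` applied to `Adj` itself decides.
  -- Shortest walks can then be found by search.
  Adj? : ∀ u v → Dec (Adj u v)
  Adj? u v = [ yes , no ]′ (walk-or-nonadjacent G acyclic id (star (connected u v)))
    where
    star : ∀ {u v} → Walk G u v → Star Adj u v
    star here       = ε
    star (step r w) = r ◅ star w

  WalkOfLength : ℕ → Fin n → Fin n → Set
  WalkOfLength zero    u v = u ≡ v
  WalkOfLength (suc d) u v = ∃ λ w → Adj u w × WalkOfLength d w v

  walkOfLength? : ∀ d u v → Dec (WalkOfLength d u v)
  walkOfLength? zero    u v = u Fin.≟ v
  walkOfLength? (suc d) u v = Fin.any? λ w → Adj? u w ×-dec walkOfLength? d w v

  walkLength : ∀ {u v} → Walk G u v → ∃ λ d → WalkOfLength d u v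
  walkLength here       = 0 , refl
  walkLength (step r w) with d , w′ ← walkLength w = suc d , -, r , w′

  abstract

    shortest : ∀ u v → ∃ λ d → WalkOfLength d u v × (∀ {j} → WalkOfLength j u v → d ≤ j)
    shortest u v = least (λ d → walkOfLength? d u v) (proj₂ (walkLength (connected u v)))

  distance : Fin n → Fin n → ℕ
  distance u v = proj₁ (shortest u v)

  distance-minimal : ∀ {u v j} → WalkOfLength j u v → distance u v ≤ j
  distance-minimal {u} {v} = proj₂ (proj₂ (shortest u v))

  distance-self : ∀ v → distance v v ≡ 0
  distance-self v = n≤0⇒n≡0 (distance-minimal {j = 0} refl)

  private
    -- The witness is the second vertex of a shortest walk.
    toward : ∀ {v z} → v ≢ z → ∃ λ w → Adj v w × distance v z ≡ suc (distance w z)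
    toward {v} {z} v≢z with shortest v z
    ... | zero  , v≡z , _ = ⊥-elim (v≢z v≡z)
    ... | suc d , (w , vw , walk) , min = w , vw ,
      ≤-antisym (min (w , vw , proj₁ (proj₂ (shortest w z)))) (s≤s (distance-minimal walk))

  parent : Fin n → Fin n → Fin n
  parent z v with v Fin.≟ z
  ... | yes _  = v
  ... | no v≢z = proj₁ (toward v≢z)

  parent-spec : ∀ z {v} → v ≢ z → Adj v (parent z v) × distance v z ≡ suc (distance (parent z v) z)
  parent-spec z {v} v≢z with v Fin.≟ z
  ... | yes v≡z = ⊥-elim (v≢z v≡z)
  ... | no v≢z′ = proj₂ (toward v≢z′)

  module _ (z : Fin n) where

    ParentEdge : Fin n → Fin n → Set
    ParentEdge u v = (u ≢ z × parent z u ≡ v) ⊎ (v ≢ z × parent z v ≡ u)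

    -- The parent edges form a spanning connected subgraph of an acyclic graph, hence they are all edges.
    edge⇒parentEdge : ∀ {u v} → Adj u v → ParentEdge u v
    edge⇒parentEdge {u} {v} uv =
      [ id , (λ ¬uv → ⊥-elim (¬uv uv)) ]′ (walk-or-nonadjacent G acyclic sub (to-root _ u refl ◅◅ reverse swap (to-root _ v refl)))
      where
      sub : ∀ {u v} → ParentEdge u v → Adj u v
      sub (inj₁ (u≢ , refl)) = proj₁ (parent-spec z u≢)
      sub (inj₂ (v≢ , refl)) = Adj-sym (proj₁ (parent-spec z v≢))
      to-root : ∀ d v → distance v z ≡ d → Star ParentEdge v z
      to-root d v e with v Fin.≟ z
      to-root d       v e | yes refl = ε
      to-root zero    v e | no v≢ with () ← trans (sym e) (proj₂ (parent-spec z v≢))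
      to-root (suc d) v e | no v≢ = inj₁ (v≢ , refl) ◅ to-root d (parent z v) (suc-injective (trans (sym (proj₂ (parent-spec z v≢))) e))

    private
      farther : ∀ {x y} → x ≢ z → parent z x ≡ y → distance x z ≡ suc (distance y z)
      farther x≢ refl = proj₂ (parent-spec z x≢)

    -- Only the parent of p is nearer to z than p; every other neighbour is one step farther. So u
    -- and v are one of each kind, with equality, or both farther.
    distance-convex : ∀ {u p v} → Adj p u → Adj p v → u ≢ v → distance p z + distance p z ≤ distance u z + distance v z
    distance-convex {u} {p} {v} pu pv u≢v with edge⇒parentEdge pu | edge⇒parentEdge pv
    ... | inj₁ (_ , e)  | inj₁ (_ , e′)  = ⊥-elim (u≢v (trans (sym e) e′))
    ... | inj₁ (p≢ , e) | inj₂ (v≢ , e′) = ≤-reflexive (trans (cong (_+ distance p z) (farther p≢ e))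
      (trans (sym (+-suc (distance u z) (distance p z))) (cong (distance u z +_) (sym (farther v≢ e′)))))
    ... | inj₂ (u≢ , e) | inj₁ (p≢ , e′) = ≤-reflexive (trans (cong (distance p z +_) (farther p≢ e′))
      (trans (+-suc (distance p z) (distance v z)) (cong (_+ distance v z) (sym (farther u≢ e)))))
    ... | inj₂ (u≢ , e) | inj₂ (v≢ , e′) = +-mono-≤ (<⇒≤ (≤-reflexive (sym (farther u≢ e)))) (<⇒≤ (≤-reflexive (sym (farther v≢ e′))))

  module Automorphism (π : Permutation′ n) (aut : IsAutomorphism G π) where
    private
      σ : Fin n → Fin n
      σ = π ⟨$⟩ʳ_

      walk⁺ : ∀ d {u v} → WalkOfLength d u v → WalkOfLength d (σ u) (σ v)
      walk⁺ zero    refl          = refl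
      walk⁺ (suc d) (w , uw , ws) = σ w , Equivalence.to (aut _ w) uw , walk⁺ d ws

      walk⁻ : ∀ d {u v} → WalkOfLength d (σ u) (σ v) → WalkOfLength d u v
      walk⁻ zero    e             = trans (sym (inverseˡ π)) (trans (cong (π ⟨$⟩ˡ_) e) (inverseˡ π))
      walk⁻ (suc d) (w , uw , ws) = π ⟨$⟩ˡ w ,
        Equivalence.from (aut _ _) (subst (Adj _) (sym (inverseʳ π)) uw) ,
        walk⁻ d (subst (λ x → WalkOfLength d x _) (sym (inverseʳ π)) ws)

    distance-automorphism : ∀ u v → distance (σ u) (σ v) ≡ distance u v
    distance-automorphism u v = ≤-antisym (distance-minimal (walk⁺ _ (proj₁ (proj₂ (shortest u v)))))
                                          (distance-minimal (walk⁻ _ (proj₁ (proj₂ (shortest (σ u) (σ v))))))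

  open Automorphism using (distance-automorphism) public

  -- Sums of distances and the centre.

  remoteness : Fin n → ℕ
  remoteness v = sum (distance v)

  remoteness-automorphism : ∀ π → IsAutomorphism G π → ∀ v → remoteness (π ⟨$⟩ʳ v) ≡ remoteness v
  remoteness-automorphism π aut v = trans (sum-permute (distance (π ⟨$⟩ʳ v)) π) (sum-cong-≗ (distance-automorphism π aut v))

  -- `distance-convex` is summed over z. It is strict at z = p, where the left side vanishes and u
  -- has positive distance.
  remoteness-convex : ∀ {u p v} → Adj p u → Adj p v → u ≢ v → remoteness p + remoteness p < remoteness u + remoteness v
  remoteness-convex {u} {p} {v} pu pv u≢v = subst₂ _<_ (∑-distrib-+ (distance p) (distance p)) (∑-distrib-+ (distance u) (distance v))
    (sum-mono-< (λ z → distance-convex z pu pv u≢v) p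
      (≤-trans (s≤s (≤-reflexive (cong₂ _+_ (distance-self p) (distance-self p))))
        (≤-trans (positive u p (λ { refl → Adj-irrefl pu })) (m≤m+n _ _))))
    where
    positive : ∀ x z → x ≢ z → 1 ≤ distance x z
    positive x z x≢ = ≤-trans (s≤s z≤n) (≤-reflexive (sym (proj₂ (parent-spec z x≢))))

  module _ (c : Fin n) (c-min : ∀ v → remoteness c ≤ remoteness v) where

    private
      -- Let p be the parent of v and g that of p. If p is not c, then g is at most as remote as p
      -- by induction, and convexity at p makes p strictly less remote than v. If p is c, minimality
      -- suffices.
      along : ∀ d v → distance v c ≡ d → v ≢ c → remoteness (parent c v) ≤ remoteness v × (parent c v ≢ c → remoteness c < remoteness v)
      along zero v e v≢ with () ← trans (sym e) (proj₂ (parent-spec c v≢))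
      along (suc d) v e v≢ with parent c v Fin.≟ c
      ... | yes p≡c = subst (λ x → remoteness x ≤ _) (sym p≡c) (c-min v) , λ p≢c → ⊥-elim (p≢c p≡c)
      ... | no p≢c = <⇒≤ p<v , λ _ → ≤-<-trans (c-min p) p<v
        where
        p g : Fin n
        p = parent c v
        g = parent c p
        vp : Adj v p × distance v c ≡ suc (distance p c)
        vp = parent-spec c v≢
        pg : Adj p g × distance p c ≡ suc (distance g c)
        pg = parent-spec c p≢c
        g≢v : g ≢ v
        g≢v g≡v = <-asym (n<1+n (distance g c)) (≤-reflexive
          (sym (trans (cong (λ x → distance x c) g≡v) (trans (proj₂ vp) (cong suc (proj₂ pg))))))
        g≤p : remoteness g ≤ remoteness p
        g≤p = proj₁ (along d p (suc-injective (trans (sym (proj₂ vp)) e)) p≢c)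
        p<v : remoteness p < remoteness v
        p<v = +-cancelˡ-< (remoteness p) _ _
          (<-≤-trans (remoteness-convex (proj₁ pg) (Adj-sym (proj₁ vp)) g≢v) (+-monoˡ-≤ (remoteness v) g≤p))

    minimal⇒near : ∀ {v} → remoteness v ≡ remoteness c → v ≡ c ⊎ Adj v c
    minimal⇒near {v} e with v Fin.≟ c
    ... | yes v≡c = inj₁ v≡c
    ... | no v≢c with parent c v Fin.≟ c
    ...   | yes p≡c = inj₂ (subst (Adj v) p≡c (proj₁ (parent-spec c v≢c)))
    ...   | no p≢c  = ⊥-elim (<-irrefl (sym e) (proj₂ (along _ v refl v≢c) p≢c))

    centre-fixed : ∀ {C : Set} (f : Fin n → C) → Proper G f → ∀ π → IsAutomorphism G π → (∀ v → f (π ⟨$⟩ʳ v) ≡ f v) → π ⟨$⟩ʳ c ≡ c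
    centre-fixed f proper π aut same = [ id , (λ adj → ⊥-elim (proper _ _ adj (same c))) ]′ (minimal⇒near (remoteness-automorphism π aut c))

  centre : Fin n → ∃ λ c → ∀ v → remoteness c ≤ remoteness v
  centre v₀ = argmin remoteness v₀ (allFin n) , λ v → All.lookup (f[argmin]≤f[xs] v₀ (allFin n)) (∈-allFin v)

  -- Equivalence of the two colourability properties.

  distColorable⇒listDistColorable : Fin n → ∀ {k} → DistColorable G k → ListDistColorable G k
  distColorable⇒listDistColorable v₀ {k} (f , f-proper , f-dist) L L-ok =
    label ∘ Y , GoodColouring.colour∈ Y-good , Y-proper , λ π aut same →
      let fixed = centre-fixed c c-min (label ∘ Y) Y-proper π aut same
      in goodColouring-rigid Y-good π aut fixed
           -- Depth is the distance to c, preserved because c is fixed.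
           (λ v → trans (cong (distance _) (sym fixed)) (distance-automorphism π aut v c)) same
    where
    c : Fin n
    c = proj₁ (centre v₀)
    c-min : ∀ v → remoteness c ≤ remoteness v
    c-min = proj₂ (centre v₀)
    open RootedTree c (parent c) (λ v → distance v c) (distance-self c) (λ v≢ → proj₂ (parent-spec c v≢))
    open RootedGraph G c (parent c) (λ v → distance v c) (distance-self c) (λ v≢ → proj₂ (parent-spec c v≢))
      (λ v≢ → proj₁ (parent-spec c v≢)) (edge⇒parentEdge c)
    open Counting k
    uniform-good : Good uniform c (code (toℕ ∘ f) c)
    uniform-good = distinguishing⇒good (λ v → ∈-upTo⁺ (Fin.toℕ<n (f v)))
      (λ u v uv → f-proper u v uv ∘ Fin.toℕ-injective)
      (λ π aut same → f-dist π aut (Fin.toℕ-injective ∘ same)) c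
    colouring : ∃ (GoodColouring L)
    colouring = goodColouring L (proj₂ (list-good (proj₁ ∘ L-ok) (proj₂ ∘ L-ok) uniform-good))
    Y : Fin n → Tree
    Y = proj₁ colouring
    Y-good : GoodColouring L Y
    Y-good = proj₂ colouring
    Y-proper : Proper G (label ∘ Y)
    Y-proper = goodColouring-proper Y-good

-- Giving every vertex the list `upTo k` is admissible, and its values are elements of `Fin k`.
listDistColorable⇒distColorable : ∀ {n} (G : Graph n) {k} → ListDistColorable G k → DistColorable G k
listDistColorable⇒distColorable G {k} colorable
  with f , f∈ , proper , dist ← colorable (λ _ → upTo k) (λ _ → Unique.upTo⁺ k , ≤-reflexive (sym (length-upTo k)))
  = (λ v → fromℕ< (∈-upTo⁻ (f∈ v))) , (λ u v uv → proper u v uv ∘ back) , λ π aut same → dist π aut (back ∘ same)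
  where
  back : ∀ {u v} → fromℕ< (∈-upTo⁻ (f∈ u)) ≡ fromℕ< (∈-upTo⁻ (f∈ v)) → f u ≡ f v
  back {u} {v} = Fin.fromℕ<-injective _ _ (∈-upTo⁻ (f∈ u)) (∈-upTo⁻ (f∈ v))

isMinimum-cong : ∀ {P Q : ℕ → Set} → (∀ {k} → P k → Q k) → (∀ {k} → Q k → P k) → ∀ {k} → IsMinimum P k → IsMinimum Q k
isMinimum-cong to from (p , min) = to p , λ j j<k q → min j j<k (from q)

theorem7 : ∀ {n : ℕ} (T : Graph n) → IsTree T → ∀ (k : ℕ) → χD≡ T k ⇔ χDℓ≡ T k
theorem7 T (1≤n , connected , acyclic) k = mk⇔ (isMinimum-cong to from) (isMinimum-cong from to)
  where
  open TreeMetric T connected acyclic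
  to : ∀ {k} → DistColorable T k → ListDistColorable T k
  to = distColorable⇒listDistColorable (fromℕ< 1≤n)
  from : ∀ {k} → ListDistColorable T k → DistColorable T k
  from = listDistColorable⇒distColorable T
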